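{- Let $(S,\mathcal C)$ be a connectoid that has a normal spanning tree $T$. Then there is a bijection between the ends of $(S,\mathcal C)$ and the ends of the (graph-theoretic) tree $T$.
   Context: A connectoid is given by a set $S$ and a set $\mathcal F$ of finite subsets of $S$ such that (i) $F\cup F'\in\mathcal F$ whenever $F,F'\in\mathcal F$ and $F\cap F'\neq\emptyset$, and (ii) $\emptyset\in\mathcal F$ and $\{s\}\in\mathcal F$ for every $s\in S$. A set $C\subseteq S$ is connected if for all $x,y\in C$ there is $F\in\mathcal F$ with $F\subseteq C$ and $x,y\in F$; $\mathcal C$ is the set of connected sets and $(S,\mathcal C)$ is the connectoid. For $S'\subseteq S$, a component of $S'$ is a maximal connected subset of $S'$, and $\mathcal K(S')$ is the set of components of $S'$. "Almost all" means all but finitely many. A necklace is a connected set $N$ for which there is a family $(H_n)_{n\in\mathbb N}$ of finite connected sets with $N=\bigcup_n H_n$ and $H_i\cap H_j\neq\emptyset$ iff $|i-j|\le 1$. For a necklace $N$ and finite $X\subseteq S$, the $X$-tail of $N$ is the unique element of $\mathcal K(N\setminus X)$ containing almost all elements of $N$. Two necklaces are equivalent if for every finite $X\subseteq S$ their $X$-tails lie in the same element of $\mathcal K(S\setminus X)$. An end of $(S,\mathcal C)$ is an equivalence class of necklaces. Ends of the tree $T$ are the usual graph-theoretic ends (equivalence classes of rays). For a rooted tree $T$ with tree order $\le_T$ (root is the minimum) and $t\in V(T)$, let $\mathrm{Down}_T(t)=\{x\in V(T):x\le_T t\}$ and $\mathrm{Down}^\circ_T(t)=\mathrm{Down}_T(t)\setminus\{t\}$.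 A weak normal tree of $(S,\mathcal C)$ is a rooted undirected tree $T$ with $V(T)\subseteq S$ such that (1) for every $C\in\mathcal C$ and every two $\le_T$-incomparable $u,v\in C\cap V(T)$ there is $w\in C$ with $w\le_T u$ and $w\le_T v$, and (2) for all $u\le_T v$ in $V(T)$ there is $C\in\mathcal C$ containing $u$ and $v$ with $C\cap\mathrm{Down}^\circ_T(u)=\emptyset$. It is a normal tree if additionally for every rooted ray $R$ of $T$ (ray starting at the root) there is a necklace containing almost all vertices of $R$. It is spanning if $V(T)=S$. -}

module Defs where

open import Data.List using (List; []; _∷_; [_])
open import Data.List.Membership.Propositional using () renaming (_∈_ to _∈ₗ_)
open import Data.List.Relation.Unary.All using (All)
open import Data.List.Relation.Unary.Unique.Propositional using (Unique)
open import Data.Nat using (ℕ; suc; _≤_; ∣_-_∣)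
open import Data.Product using (∃; ∃₂; ∃-syntax; _×_; proj₁)
open import Function.Bundles using (_⇔_)
open import Level using () renaming (suc to lsuc)
open import Relation.Binary.Construct.Closure.ReflexiveTransitive using (Star; ε; _◅_)
open import Relation.Binary.Core using (Rel)
open import Relation.Binary.Definitions using (Symmetric; Irreflexive; _Respects_)
open import Relation.Binary.PropositionalEquality using (_≡_)
open import Relation.Nullary using (¬_)
open import Relation.Unary using (Pred; _∈_; _∉_; _⊆_; _≐_; _∪_; _∩_; _∖_; ∁; ⋃; _≬_; _⊥_; ｛_｝)
open import Relation.Unary.Polymorphic using (∅)

-- Subsets of S are predicates, compared by extensional equality _≐_.
-- P ≬ Q says that P ∩ Q is inhabited, and P ⊥ Q that it is empty.

Finite : ∀ {a ℓ} {A : Set a} → Pred A ℓ → Set _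
Finite P = ∃[ xs ] P ≐ (_∈ₗ xs)

-- All but finitely many elements of P lie in Q.
_⊆ᶠ_ : ∀ {a ℓ₁ ℓ₂} {A : Set a} → Pred A ℓ₁ → Pred A ℓ₂ → Set _
P ⊆ᶠ Q = Finite (P ∖ Q)

record Connectoid {a} (S : Set a) : Set (lsuc a) where
  field
    𝓕      : Pred (Pred S a) a
    -- 𝓕 is a set of subsets, so it may not distinguish extensionally equal
    -- predicates.
    𝓕-resp : 𝓕 Respects _≐_
    finite : ∀ {F} → F ∈ 𝓕 → Finite F
    ∪-∈    : ∀ {F F′} → F ∈ 𝓕 → F′ ∈ 𝓕 → F ≬ F′ → (F ∪ F′) ∈ 𝓕
    ∅-∈    : ∅ ∈ 𝓕
    ｛｝-∈  : ∀ s → ｛ s ｝ ∈ 𝓕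

  Connected : Pred S a → Set (lsuc a)
  Connected C = ∀ {x y} → x ∈ C → y ∈ C →
    ∃[ F ] F ∈ 𝓕 × F ⊆ C × x ∈ F × y ∈ F

  record IsComponent (S′ K : Pred S a) : Set (lsuc a) where
    field
      subset    : K ⊆ S′
      connected : Connected K
      maximal   : ∀ {C} → Connected C → C ⊆ S′ → K ⊆ C → C ⊆ K

  𝓚 : Pred S a → Pred (Pred S a) (lsuc a)
  𝓚 = IsComponent

  record IsNecklace (N : Pred S a) : Set (lsuc a) where
    field
      connected   : Connected N
      H           : ℕ → Pred S a
      H-finite    : ∀ n → Finite (H n)
      H-connected : ∀ n → Connected (H n)
      N≐⋃H        : N ≐ ⋃ ℕ H
      H-meet      : ∀ i j → (H i ≬ H j) ⇔ (∣ i - j ∣ ≤ 1)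

  Necklace : Set (lsuc a)
  Necklace = ∃ IsNecklace

  IsTail : (X N K : Pred S a) → Set (lsuc a)
  IsTail X N K = K ∈ 𝓚 (N ∖ X) × N ⊆ᶠ K

  -- The ends of the connectoid are the classes of this relation.  Tails are
  -- unique, and "the X-tail of N" is read as "some K with IsTail X N K".
  _≈ᴺ_ : Rel Necklace (lsuc a)
  N₁ ≈ᴺ N₂ = ∀ (X : Pred S a) → Finite X →
    ∃[ D ] D ∈ 𝓚 (∁ X) ×
      (∃[ K₁ ] IsTail X (proj₁ N₁) K₁ × K₁ ⊆ D) ×
      (∃[ K₂ ] IsTail X (proj₁ N₂) K₂ × K₂ ⊆ D)

-- Simple undirected graphs whose vertices are elements of S.
record Graph {a} (S : Set a) : Set (lsuc a) where
  field
    V        : Pred S a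
    E        : Rel S a
    E⊆V      : ∀ {u v} → E u v → u ∈ V
    E-sym    : Symmetric E
    E-irrefl : Irreflexive _≡_ E

  Walk : Rel S a
  Walk = Star E

  vertices : ∀ {u v} → Walk u v → List S
  vertices {u} ε       = [ u ]
  vertices {u} (_ ◅ p) = u ∷ vertices p

  IsPath : ∀ {u v} → Walk u v → Set a
  IsPath p = Unique (vertices p)

  -- A cycle is a path on at least three vertices (that is, with at least two
  -- edges) whose endpoints are adjacent.
  data Cycle : Set a where
    cycle : ∀ {u w x v} (e : E u w) (f : E w x) (p : Walk x v) →
            IsPath (e ◅ f ◅ p) → E v u → Cycle

  record IsTree : Set a where
    field
      connected : ∀ {u v} → u ∈ V → v ∈ V → Walk u v
      acyclic   : ¬ Cycle

  record Ray : Set a where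
    field
      at        : ℕ → S
      edge      : ∀ n → E (at n) (at (suc n))
      injective : ∀ {m n} → at m ≡ at n → m ≡ n

    vertexSet : Pred S a
    vertexSet s = ∃[ n ] at n ≡ s

  open Ray

  -- The ends of the graph are the classes of this relation: for every finite
  -- set X of vertices, both rays have a tail in the same component of the
  -- graph minus X.
  _≈ᴿ_ : Rel Ray (lsuc a)
  R₁ ≈ᴿ R₂ = ∀ (X : Pred S a) → Finite X → X ⊆ V →
    ∃₂ λ m n →
      (∀ k → m ≤ k → at R₁ k ∉ X) ×
      (∀ k → n ≤ k → at R₂ k ∉ X) ×
      (∃[ p ] All (_∉ X) (vertices {at R₁ m} {at R₂ n} p))

record RootedTree {a} (S : Set a) : Set (lsuc a) where
  field
    graph  : Graph S
    isTree : Graph.IsTree graph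
    root   : S
    root∈V : root ∈ Graph.V graph

  open Graph graph public

  -- The tree order: u lies on the path from the root to v.
  _≤ᵀ_ : Rel S a
  u ≤ᵀ v = ∃[ p ] IsPath {root} {v} p × u ∈ₗ vertices p

  Down : S → Pred S a
  Down t x = x ≤ᵀ t

  Down° : S → Pred S a
  Down° t = Down t ∖ ｛ t ｝

  IsRooted : Ray → Set a
  IsRooted R = Ray.at R 0 ≡ root

  IsSpanning : Set a
  IsSpanning = ∀ s → s ∈ V

module _ {a} {S : Set a} (𝒞 : Connectoid S) (T : RootedTree S) where
  open Connectoid 𝒞 using (Connected; Necklace)
  open RootedTree T

  record IsWeakNormalTree : Set (lsuc a) where
    field
      incomparable : ∀ {C u v} → Connected C → u ∈ C ∩ V → v ∈ C ∩ V →
        ¬ (u ≤ᵀ v) → ¬ (v ≤ᵀ u) → ∃[ w ] w ∈ C × w ≤ᵀ u × w ≤ᵀ v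
      comparable   : ∀ {u v} → u ∈ V → v ∈ V → u ≤ᵀ v →
        ∃[ C ] Connected C × u ∈ C × v ∈ C × C ⊥ Down° u

  record IsNormalTree : Set (lsuc a) where
    field
      isWeakNormalTree : IsWeakNormalTree
      rays             : ∀ R → IsRooted R →
        ∃ λ (N : Necklace) → Ray.vertexSet R ⊆ᶠ proj₁ N

{-# OPTIONS --safe #-}
module Submission where

open import Defs
open import Axiom.ExcludedMiddle using (ExcludedMiddle)
open import Data.Empty using (⊥-elim)
open import Data.List using (List; []; _∷_; _++_; length; filter; map)
open import Data.List.Extrema.Nat using (max; xs≤max)
open import Data.List.Membership.Propositional using () renaming (_∈_ to _∈ₗ_)
open import Data.List.Membership.Propositional.Properties
  using (∈-++⁺ˡ; ∈-++⁺ʳ; ∈-++⁻; ∈-map⁺; ∈-filter⁺; ∈-filter⁻)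
open import Data.List.Properties using (∷-injectiveʳ)
open import Data.List.Relation.Unary.All as All using (All; []; _∷_)
open import Data.List.Relation.Unary.AllPairs using ([]; _∷_)
open import Data.List.Relation.Unary.Any using (here; there)
open import Data.Nat using (ℕ; zero; suc; _+_; _∸_; _⊔_; _≤_; _<_; z≤n; s≤s; s≤s⁻¹; ∣_-_∣)
open import Data.Nat.Properties
open import Data.Product using (∃; ∃-syntax; _×_; _,_; proj₁; proj₂)
open import Data.Sum using (_⊎_; inj₁; inj₂)
open import Function using (_∘_; id; case_of_)
open import Function.Bundles using (Equivalence)
open import Function.Structures using (IsBijection)
open import Level using () renaming (_⊔_ to _⊔ˡ_)
open import Relation.Binary.Construct.Closure.ReflexiveTransitive using (ε; _◅_)
open import Relation.Binary.PropositionalEquality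
  using (_≡_; _≢_; refl; sym; trans; cong; subst)
open import Relation.Binary.Structures using (IsEquivalence)
open import Relation.Nullary using (¬_; yes; no)
open import Relation.Unary using (Pred; _∈_; _∉_; _⊆_; _∪_; _∖_; ∁; _≬_; ｛_｝; U)

-- A connected set has a ≤ᵀ-minimum, and the up-closure of t is the connected
-- component above t once Down° t is removed.  For a necklace N, the vertices t
-- whose up-closure contains a tail of N form a chain; it is unbounded, because
-- the minimum of a tail of N avoiding Down t lies strictly above t.  So they are
-- the vertices of a rooted ray, the image of N.  Two necklaces are equivalent iff
-- they have the same such t: whether t belongs to them is seen by removing the
-- finite set Down° t, and conversely every finite X misses the up-closure of some t of a
-- given rooted ray.  A ray of T eventually ascends, hence is equivalent to a
-- rooted ray, and this is the image of any necklace through almost all of its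
-- vertices.

-- Finite sets, and points leaving a sequence of sets.

module _ (em : ∀ {ℓ} → ExcludedMiddle ℓ) {a} {A : Set a} where

  finite-⊆ : ∀ {ℓ} {P : Pred A ℓ} xs → P ⊆ (_∈ₗ xs) → Finite P
  finite-⊆ xs P⊆xs = filter (λ _ → em) xs
    , (λ x∈P → ∈-filter⁺ (λ _ → em) (P⊆xs x∈P) x∈P)
    , (λ x∈ → proj₂ (∈-filter⁻ (λ _ → em) {xs = xs} x∈))

  -- Each listed point has its own departure time, and a maximum of these works for all; a point in
  -- no `Q i` imposes no bound. Applied to the vertices of a ray and to the sets `H n` of a
  -- necklace.
  eventually-avoids : ∀ {ℓ} {Q : ℕ → Pred A ℓ} →
    (∀ {x i} → x ∈ Q i → ∃[ m ] ∀ {n} → m ≤ n → x ∉ Q n) →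
    ∀ xs → ∃[ m ] ∀ {n} → m ≤ n → ∀ {x} → x ∈ₗ xs → x ∉ Q n
  eventually-avoids leaves [] = 0 , λ _ ()
  eventually-avoids {Q = Q} leaves (x ∷ xs)
    with eventually-avoids leaves xs | em {P = ∃[ i ] x ∈ Q i}
  ... | m , avoids | no  never = m , λ where
    m≤n (here refl) x∈ → never (_ , x∈)
    m≤n (there y∈)  → avoids m≤n y∈
  ... | m , avoids | yes (_ , x∈) with leaves x∈
  ...   | k , left = m ⊔ k , λ where
    ≤n (here refl) → left (m⊔n≤o⇒n≤o m k ≤n)
    ≤n (there y∈)  → avoids (m⊔n≤o⇒m≤o m k ≤n) y∈

-- Walks and unique paths in acyclic graphs.

module UniquePath (em : ∀ {ℓ} → ExcludedMiddle ℓ) {a} {S : Set a} (G : Graph S)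
                  (acyclic : ¬ Graph.Cycle G) where
  open Graph G

  Reach : ∀ {p} → Pred S p → S → S → Set _
  Reach P u v = ∃ λ (p : Walk u v) → All P (vertices p)

  module _ {ℓ} {P : Pred S ℓ} where

    reach-trans : ∀ {u v w} → Reach P u v → Reach P v w → Reach P u w
    reach-trans (ε     , _)      r = r
    reach-trans (e ◅ p , x ∷ ps) r =
      let q , qs = reach-trans (p , ps) r in e ◅ q , x ∷ qs

    head-all : ∀ {u v} (p : Walk u v) → All P (vertices p) → P u
    head-all ε       (x ∷ _) = x
    head-all (_ ◅ _) (x ∷ _) = x

    reach-sym : ∀ {u v} → Reach P u v → Reach P v u
    reach-sym (ε , ps) = ε , ps
    reach-sym (e ◅ p , x ∷ ps) =
      reach-trans (reach-sym (p , ps)) (E-sym e ◅ ε , head-all p ps ∷ x ∷ [])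

    suffix : ∀ {u v x} (p : Walk u v) → x ∈ₗ vertices p → IsPath p → All P (vertices p) →
      ∃ λ (q : Walk x v) → IsPath q × All P (vertices q)
    suffix ε       (here refl) up      ps       = ε , up , ps
    suffix (e ◅ p) (here refl) up      ps       = e ◅ p , up , ps
    suffix (e ◅ p) (there x∈)  (_ ∷ up) (_ ∷ ps) = suffix p x∈ up ps

    erase-loops : ∀ {u v} → Reach P u v →
      ∃ λ (q : Walk u v) → IsPath q × All P (vertices q)
    erase-loops (ε , ps) = ε , [] ∷ [] , ps
    erase-loops {u} (e ◅ p , x ∷ ps) with erase-loops (p , ps)
    ... | q , uq , qs with em {P = u ∈ₗ vertices q}
    ...   | yes u∈ = suffix q u∈ uq qs
    ...   | no  u∉ = e ◅ q , All.tabulate (λ y∈ u≡y → u∉ (subst (_∈ₗ vertices q) (sym u≡y) y∈)) ∷ uq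
                   , x ∷ qs

  head∈ : ∀ {u v} (p : Walk u v) → u ∈ₗ vertices p
  head∈ ε       = here refl
  head∈ (_ ◅ _) = here refl

  last∈ : ∀ {u v} (p : Walk u v) → v ∈ₗ vertices p
  last∈ ε       = here refl
  last∈ (_ ◅ p) = there (last∈ p)

  -- Where two paths with the same ends diverge, at v, their next vertices are
  -- joined by a walk avoiding v, which closes up to a cycle.
  path-unique : ∀ {v w} (p q : Walk v w) → IsPath p → IsPath q → vertices p ≡ vertices q
  path-unique ε ε _ _ = refl
  path-unique ε (_ ◅ q) _ (v∉ ∷ _) = ⊥-elim (All.lookup v∉ (last∈ q) refl)
  path-unique (_ ◅ p) ε (v∉ ∷ _) _ = ⊥-elim (All.lookup v∉ (last∈ p) refl)
  path-unique {v} (_◅_ {j = x} e p) (_◅_ {j = y} f q) (v∉p ∷ up) (v∉q ∷ uq)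
    with em {P = x ≡ y}
  ... | yes refl = cong (v ∷_) (path-unique p q up uq)
  ... | no  x≢y with erase-loops (reach-trans (p , v∉p) (reach-sym (q , v∉q)))
  ...   | ε     , _  , _  = ⊥-elim (x≢y refl)
  ...   | g ◅ r , ur , v∉ = ⊥-elim (acyclic (cycle e g r (v∉ ∷ ur) (E-sym f)))

  -- Loop erasure alone does not tell which vertices survive. Reversing `q` once more gives a path
  -- `r` inside `q`, and by uniqueness `r` has the vertices of `p`.
  reverse-path : ∀ {u v} (p : Walk u v) → IsPath p →
    ∃ λ (q : Walk v u) → IsPath q × All (_∈ₗ vertices q) (vertices p)
  reverse-path p up
    with q , uq , _  ← erase-loops (reach-sym (p , All.universal-U (vertices p)))
    with r , ur , r⊆ ← erase-loops (reach-sym (q , All.tabulate {P = _∈ₗ vertices q} id))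
    = q , uq , subst (All (_∈ₗ vertices q)) (path-unique r p ur up) r⊆

-- The order of a rooted spanning tree.

module TreeOrder (em : ∀ {ℓ} → ExcludedMiddle ℓ) {a} {S : Set a} (T : RootedTree S)
                 (spanning : RootedTree.IsSpanning T) where
  open RootedTree T
  open Graph.IsTree isTree
  open UniquePath em graph acyclic public

  private
    rootPath : ∀ v → ∃ λ (p : Walk v root) → IsPath p × All U (vertices p)
    rootPath v = erase-loops (_ , All.universal-U (vertices (connected (spanning v) root∈V)))

  -- Listed from v down to the root, so that passing to the parent drops the head.
  down : S → List S
  down v = vertices (proj₁ (rootPath v))

  infix 4 _≼_
  _≼_ : S → S → Set a
  u ≼ v = u ∈ₗ down v

  -- A list equation instead of an edge, so that `≼` and `height` pass to the child by `subst` and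
  -- `cong`.
  Child : S → S → Set a
  Child u v = down v ≡ v ∷ down u

  height : S → ℕ
  height v = length (down v)

  ≤ᵀ⇒≼ : ∀ {u v} → u ≤ᵀ v → u ≼ v
  ≤ᵀ⇒≼ {v = v} (p , up , u∈p) with q , uq , p⊆q ← reverse-path p up =
    subst (_ ∈ₗ_) (path-unique q _ uq (proj₁ (proj₂ (rootPath v)))) (All.lookup p⊆q u∈p)

  ≼⇒≤ᵀ : ∀ {u v} → u ≼ v → u ≤ᵀ v
  ≼⇒≤ᵀ {v = v} u≼v
    with q , uq , p⊆q ← reverse-path (proj₁ (rootPath v)) (proj₁ (proj₂ (rootPath v))) =
    q , uq , All.lookup p⊆q u≼v

  down-path : ∀ {v} (p : Walk v root) → IsPath p → down v ≡ vertices p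
  down-path {v} p up = path-unique _ p (proj₁ (proj₂ (rootPath v))) up

  down-root : down root ≡ root ∷ []
  down-root = down-path ε ([] ∷ [])

  ≼-refl : ∀ {v} → v ≼ v
  ≼-refl {v} = head∈ (proj₁ (rootPath v))

  root-or-child : ∀ v → v ≡ root ⊎ (∃[ u ] E u v × Child u v)
  root-or-child v with rootPath v
  ... | ε , _ = inj₁ refl
  ... | e ◅ p , _ ∷ up , _ = inj₂ (_ , E-sym e , cong (v ∷_) (sym (down-path p up)))

  -- As `v` is not on the path from `u` to the root, prepending it gives a path again, and paths are
  -- unique.
  edge-child : ∀ {u v} → E u v → ¬ (v ≼ u) → Child u v
  edge-child {u} {v} e v⋠u with rootPath u
  ... | p , up , _ = down-path (E-sym e ◅ p)
    (All.tabulate (λ x∈ v≡x → v⋠u (subst (_∈ₗ vertices p) (sym v≡x) x∈)) ∷ up)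

  tree-induction : ∀ {ℓ} (P : S → Set ℓ) → P root → (∀ {u v} → Child u v → P u → P v) →
    ∀ v → P v
  tree-induction P base step v = go (down v) v refl
    where
    -- The list is an argument of its own because its tail, the list of the parent, makes the
    -- recursion structural.
    go : ∀ xs v → down v ≡ xs → P v
    go xs v eq with root-or-child v
    ... | inj₁ refl = base
    go []       v eq | inj₂ (_ , _ , c) = case trans (sym eq) c of λ ()
    go (_ ∷ xs) v eq | inj₂ (u , _ , c) = step c (go xs u (sym (∷-injectiveʳ (trans (sym eq) c))))

  ≼-root : ∀ {u} → u ≼ root → u ≡ root
  ≼-root u≼ with here eq ← subst (_ ∈ₗ_) down-root u≼ = eq

  ≼-child : ∀ {u v w} → Child u v → w ≼ v → w ≡ v ⊎ w ≼ u
  ≼-child c w≼v with subst (_ ∈ₗ_) c w≼v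
  ... | here eq   = inj₁ eq
  ... | there w≼u = inj₂ w≼u

  child-≼ : ∀ {u v w} → Child u v → w ≼ u → w ≼ v
  child-≼ c w≼u = subst (_ ∈ₗ_) (sym c) (there w≼u)

  height-root : height root ≡ 1
  height-root = cong length down-root

  height-child : ∀ {u v} → Child u v → height v ≡ suc (height u)
  height-child = cong length

  root-≼ : ∀ v → root ≼ v
  root-≼ = tree-induction _ ≼-refl child-≼

  ≼-trans : ∀ {u v w} → u ≼ v → v ≼ w → u ≼ w
  ≼-trans {u} {v} {w} u≼v = tree-induction (λ w → v ≼ w → u ≼ w)
    (λ v≼ → subst (u ≼_) (≼-root v≼) u≼v)
    (λ c ih v≼ → case ≼-child c v≼ of λ where
      (inj₁ refl) → u≼v
      (inj₂ v≼)   → child-≼ c (ih v≼))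
    w

  ≼⇒≡⊎< : ∀ {u v} → u ≼ v → u ≡ v ⊎ height u < height v
  ≼⇒≡⊎< {u} {v} = tree-induction (λ v → u ≼ v → u ≡ v ⊎ height u < height v)
    (inj₁ ∘ ≼-root)
    (λ c ih u≼ → case ≼-child c u≼ of λ where
      (inj₁ u≡v) → inj₁ u≡v
      (inj₂ u≼)  → inj₂ (subst (_ <_) (sym (height-child c)) (s≤s (case ih u≼ of λ where
        (inj₁ refl) → ≤-refl
        (inj₂ lt)   → <⇒≤ lt))))
    v

  ≼⇒height≤ : ∀ {u v} → u ≼ v → height u ≤ height v
  ≼⇒height≤ u≼v with ≼⇒≡⊎< u≼v
  ... | inj₁ refl = ≤-refl
  ... | inj₂ lt   = <⇒≤ lt

  ≼-below-total : ∀ {u v w} → u ≼ w → v ≼ w → u ≼ v ⊎ v ≼ u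
  ≼-below-total {u} {v} {w} = tree-induction (λ w → u ≼ w → v ≼ w → u ≼ v ⊎ v ≼ u)
    (λ u≼ v≼ → inj₁ (subst (u ≼_) (sym (≼-root v≼)) u≼))
    (λ c ih u≼ v≼ → case ≼-child c u≼ , ≼-child c v≼ of λ where
      (inj₁ refl , _)         → inj₂ v≼
      (inj₂ _    , inj₁ refl) → inj₁ u≼
      (inj₂ u≼   , inj₂ v≼)   → ih u≼ v≼)
    w

  ≼-height-≡ : ∀ {u v} → u ≼ v → height u ≡ height v → u ≡ v
  ≼-height-≡ u≼v eq with ≼⇒≡⊎< u≼v
  ... | inj₁ u≡v = u≡v
  ... | inj₂ lt  = ⊥-elim (<-irrefl eq lt)

  comparable-height-≡ : ∀ {u v} → u ≼ v ⊎ v ≼ u → height u ≡ height v → u ≡ v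
  comparable-height-≡ (inj₁ u≼v) eq = ≼-height-≡ u≼v eq
  comparable-height-≡ (inj₂ v≼u) eq = sym (≼-height-≡ v≼u (sym eq))

  ≼-antisym : ∀ {u v} → u ≼ v → v ≼ u → u ≡ v
  ≼-antisym u≼v v≼u = ≼-height-≡ u≼v (≤-antisym (≼⇒height≤ u≼v) (≼⇒height≤ v≼u))

  ancestor-at : ∀ {n} v → n < height v → ∃[ u ] u ≼ v × height u ≡ suc n
  ancestor-at {n} = tree-induction (λ v → n < height v → ∃[ u ] u ≼ v × height u ≡ suc n)
    (λ n< → root , ≼-refl , trans height-root (sym (cong suc (n<1⇒n≡0 (subst (n <_) height-root n<)))))
    (λ {u} {v} c ih n< → case m≤n⇒m<n∨m≡n (s≤s⁻¹ (subst (n <_) (height-child c) n<)) of λ where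
      (inj₁ n<u) → let w , w≼u , eq = ih n<u in w , child-≼ c w≼u , eq
      (inj₂ eq)  → v , ≼-refl , trans (height-child c) (cong suc (sym eq)))

  adjacent : ∀ {u v} → E u v → Child u v ⊎ Child v u
  adjacent {u} {v} e with em {P = v ≼ u}
  ... | no  v⋠u = inj₁ (edge-child e v⋠u)
  ... | yes v≼u = inj₂ (edge-child (E-sym e) λ u≼v → E-irrefl (≼-antisym u≼v v≼u) e)

  parent-unique : ∀ {u v w} → Child u w → Child v w → u ≡ v
  parent-unique {u} {v} c d = ≼-antisym (subst (u ∈ₗ_) eq ≼-refl) (subst (v ∈ₗ_) (sym eq) ≼-refl)
    where
    eq : down u ≡ down v
    eq = ∷-injectiveʳ (trans (sym c) d)

  child⇒≼ : ∀ {u v} → Child u v → u ≼ v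
  child⇒≼ c = child-≼ c ≼-refl

  -- The counterpart of `Down°` for `≼`: a finite set whose deletion cuts the vertices above `t` off
  -- from the rest, in the tree and in the connectoid.
  Below : S → Pred S a
  Below t x = x ≼ t × x ≢ t

  -- The only edge that could leave the up-closure of `t` joins `t` to its parent, which lies in
  -- `Below t`.
  ≼-edge : ∀ {t u v} → E u v → v ∉ Below t → t ≼ u → t ≼ v
  ≼-edge {t} {v = v} e v∉ t≼u with adjacent e
  ... | inj₁ c = child-≼ c t≼u
  ... | inj₂ c with em {P = v ≡ t}
  ...   | yes refl = ≼-refl
  ...   | no  v≢t with ≼-below-total t≼u (child⇒≼ c)
  ...     | inj₁ t≼v = t≼v
  ...     | inj₂ v≼t = ⊥-elim (v∉ (v≼t , v≢t))

  ≼-walk : ∀ {t u v} → t ≼ u → Reach (_∉ Below t) u v → t ≼ v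
  ≼-walk t≼u (ε , _) = t≼u
  ≼-walk t≼u (e ◅ p , _ ∷ ps) = ≼-walk (≼-edge e (head-all p ps) t≼u) (p , ps)

-- Rays, branches and ends of the tree.

module Rays (em : ∀ {ℓ} → ExcludedMiddle ℓ) {a} {S : Set a} (T : RootedTree S)
            (spanning : RootedTree.IsSpanning T) where
  open RootedTree T
  open TreeOrder em T spanning public
  open Ray

  ray-avoids : ∀ (R : Ray) xs → ∃[ m ] ∀ {n} → m ≤ n → ¬ (at R n ∈ₗ xs)
  ray-avoids R xs with eventually-avoids em {Q = λ n x → at R n ≡ x}
    (λ {_} {i} i≡ → suc i , λ i<n n≡ → <-irrefl (injective R (trans i≡ (sym n≡))) i<n) xs
  ... | m , avoids = m , λ m≤n x∈ → avoids m≤n x∈ refl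

  -- Once both rays have left `X` for good they share a vertex, so a one-vertex walk joins them.
  common-tail⇒≈ᴿ : ∀ (R R′ : Ray) i j → (∀ k → at R (k + i) ≡ at R′ (k + j)) → R ≈ᴿ R′
  common-tail⇒≈ᴿ R R′ i j eq X (xs , X⊆ , _) _ =
    k + i , k + j , avoids , avoids′ , subst (Reach (_∉ X) _) (eq k) (ε , avoids _ ≤-refl ∷ [])
    where
    m  = proj₁ (ray-avoids R xs)
    m′ = proj₁ (ray-avoids R′ xs)
    k  = m ⊔ m′
    avoids : ∀ l → k + i ≤ l → at R l ∉ X
    avoids l ≤l x∈ = proj₂ (ray-avoids R xs) (≤-trans (m≤m⊔n m m′) (m+n≤o⇒m≤o k ≤l)) (X⊆ x∈)
    avoids′ : ∀ l → k + j ≤ l → at R′ l ∉ X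
    avoids′ l ≤l x∈ = proj₂ (ray-avoids R′ xs) (≤-trans (m≤n⊔m m m′) (m+n≤o⇒m≤o k ≤l)) (X⊆ x∈)

  ray-reach : ∀ {ℓ} {P : Pred S ℓ} (R : Ray) {m} d → (∀ k → m ≤ k → at R k ∈ P) →
    Reach P (at R m) (at R (d + m))
  ray-reach R zero    in-P = ε , in-P _ ≤-refl ∷ []
  ray-reach R {m} (suc d) in-P = reach-trans (ray-reach R d in-P)
    (edge R (d + m) ◅ ε , in-P _ (m≤n+m m d) ∷ in-P _ (m≤n+m m (suc d)) ∷ [])

  -- For transitivity, where the two equivalences may enter the middle ray at different indices.
  ray-reach-between : ∀ {ℓ} {P : Pred S ℓ} (R : Ray) {m n} →
    (∀ k → m ≤ k → at R k ∈ P) → (∀ k → n ≤ k → at R k ∈ P) → Reach P (at R m) (at R n)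
  ray-reach-between {P = P} R {m} {n} m-in n-in with ≤-total m n
  ... | inj₁ m≤n = subst (λ k → Reach P (at R m) (at R k)) (m∸n+n≡m m≤n) (ray-reach R (n ∸ m) m-in)
  ... | inj₂ n≤m = reach-sym
    (subst (λ k → Reach P (at R n) (at R k)) (m∸n+n≡m n≤m) (ray-reach R (m ∸ n) n-in))

  ≈ᴿ-isEquivalence : IsEquivalence _≈ᴿ_
  ≈ᴿ-isEquivalence = record
    { refl  = λ {R} → common-tail⇒≈ᴿ R R 0 0 λ _ → refl
    ; sym   = λ R≈R′ X fin X⊆V → case R≈R′ X fin X⊆V of λ where
        (m , n , m-out , n-out , r) → n , m , n-out , m-out , reach-sym r
    ; trans = λ {R₁} {R₂} {R₃} R₁≈R₂ R₂≈R₃ X fin X⊆V →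
        case R₁≈R₂ X fin X⊆V , R₂≈R₃ X fin X⊆V of λ where
          ((m , n , m-out , n-out , r) , (n′ , o , n′-out , o-out , r′)) →
            m , o , m-out , o-out ,
            reach-trans r (reach-trans (ray-reach-between R₂ n-out n′-out) r′)
    }

  -- The vertex sets of rooted rays, described without an enumeration; the ray is recovered by
  -- sorting the set by height.
  record IsBranch {ℓ} (P : Pred S ℓ) : Set (a ⊔ˡ ℓ) where
    field
      chain  : ∀ {s t} → s ∈ P → t ∈ P → s ≼ t ⊎ t ≼ s
      closed : ∀ {s t} → s ≼ t → t ∈ P → s ∈ P
      tall   : ∀ n → ∃[ t ] t ∈ P × n < height t

    private
      -- `height` counts vertices, so the root has height 1 and index `n` belongs to height `suc n`.
      level : ∀ n → ∃[ t ] t ∈ P × height t ≡ suc n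
      level n =
        let t , t∈ , n<       = tall n
            u , u≼t , height≡ = ancestor-at t n<
        in u , closed u≼t t∈ , height≡

    vertex : ℕ → S
    vertex n = proj₁ (level n)

    vertex∈ : ∀ n → vertex n ∈ P
    vertex∈ n = proj₁ (proj₂ (level n))

    height-vertex : ∀ n → height (vertex n) ≡ suc n
    height-vertex n = proj₂ (proj₂ (level n))

    vertex-unique : ∀ {t} n → t ∈ P → height t ≡ suc n → vertex n ≡ t
    vertex-unique n t∈ eq =
      comparable-height-≡ (chain (vertex∈ n) t∈) (trans (height-vertex n) (sym eq))

    vertex-edge : ∀ n → E (vertex n) (vertex (suc n))
    vertex-edge n with root-or-child (vertex (suc n))
    ... | inj₁ eq =
      case trans (sym (height-vertex (suc n))) (trans (cong height eq) height-root) of λ ()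
    -- The parent `u` is in `P` by closure and one lower, so it is `vertex n`.
    ... | inj₂ (u , e , c) = subst (λ w → E w _) (sym (vertex-unique n
      (closed (child⇒≼ c) (vertex∈ (suc n)))
      (suc-injective (trans (sym (height-child c)) (height-vertex (suc n)))))) e

    ray : Ray
    ray = record
      { at        = vertex
      ; edge      = vertex-edge
      ; injective = λ {m} {n} eq → suc-injective
          (trans (sym (height-vertex m)) (trans (cong height eq) (height-vertex n)))
      }

    ray-rooted : IsRooted ray
    ray-rooted = sym (≼-height-≡ (root-≼ _) (trans height-root (sym (height-vertex 0))))

  -- One inclusion suffices, since a branch has exactly one vertex of each positive height.
  branch-⊆⇒≡ : ∀ {ℓ ℓ′} {P : Pred S ℓ} {Q : Pred S ℓ′} (p : IsBranch P) (q : IsBranch Q) →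
    P ⊆ Q → ∀ n → IsBranch.vertex p n ≡ IsBranch.vertex q n
  branch-⊆⇒≡ p q P⊆Q n =
    sym (IsBranch.vertex-unique q n (P⊆Q (IsBranch.vertex∈ p n)) (IsBranch.height-vertex p n))

  -- A rooted ray in the end of a given ray.

  module _ (R : Ray) where

    private
      Ascends : ℕ → Set a
      Ascends n = Child (at R n) (at R (suc n))

    -- A ray cannot return to the vertex it has just left, so it never turns downwards.
    keeps-ascending : ∀ {n} → Ascends n → Ascends (suc n)
    keeps-ascending {n} c with adjacent (edge R (suc n))
    ... | inj₁ d = d
    ... | inj₂ d = ⊥-elim (<-irrefl (injective R (parent-unique c d)) (m<n+m n (s≤s z≤n)))

    -- Each descending step lowers the height, so the height of the first vertex bounds the number
    -- of initial descents.
    turns-upwards : ∃ Ascends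
    turns-upwards = go (height (at R 0)) 0 ≤-refl
      where
      go : ∀ b n → height (at R n) ≤ b → ∃ Ascends
      go b n ≤b with adjacent (edge R n)
      ... | inj₁ c = n , c
      go zero    n ≤b | inj₂ c = case subst (_≤ 0) (height-child c) ≤b of λ ()
      go (suc b) n ≤b | inj₂ c = go b (suc n) (s≤s⁻¹ (subst (_≤ suc b) (height-child c) ≤b))

    private
      m = proj₁ turns-upwards

      ascends : ∀ k → Ascends (k + m)
      ascends zero    = proj₂ turns-upwards
      ascends (suc k) = keeps-ascending (ascends k)

      ascending : ∀ k j → at R (k + m) ≼ at R (j + k + m)
      ascending k zero    = ≼-refl
      ascending k (suc j) = child-≼ (ascends (j + k)) (ascending k j)

      ascending-≤ : ∀ {i j} → i ≤ j → at R (i + m) ≼ at R (j + m)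
      ascending-≤ {i} {j} i≤j =
        subst (λ l → at R (i + m) ≼ at R (l + m)) (m∸n+n≡m i≤j) (ascending i (j ∸ i))

      height-tail : ∀ k → height (at R (k + m)) ≡ k + height (at R m)
      height-tail zero    = refl
      height-tail (suc k) = trans (height-child (ascends k)) (cong suc (height-tail k))

    -- Closing the ascending tail downwards replaces the start of `R` by the path from the root.
    BelowTail : Pred S a
    BelowTail t = ∃[ k ] t ≼ at R (k + m)

    belowTail-isBranch : IsBranch BelowTail
    belowTail-isBranch = record
      { chain  = λ (i , s≼) (j , t≼) → ≼-below-total
          (≼-trans s≼ (ascending-≤ (m≤m⊔n i j))) (≼-trans t≼ (ascending-≤ (m≤n⊔m i j)))
      ; closed = λ s≼t (k , t≼) → k , ≼-trans s≼t t≼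
      ; tall   = λ n → _ , (suc n , ≼-refl) ,
          subst (n <_) (sym (height-tail (suc n))) (s≤s (m≤m+n n _))
      }

    open IsBranch belowTail-isBranch

    rooted-≈ᴿ : ray ≈ᴿ R
    -- Heights exceed indices in `ray` by one: its vertex at `k + height (at R m)` has the height of
    -- `R` at `suc k + m`, hence the shift to `suc m`.
    rooted-≈ᴿ = common-tail⇒≈ᴿ ray R (height (at R m)) (suc m) λ k →
      vertex-unique (k + height (at R m))
        (suc k , subst (λ l → at R (k + suc m) ≼ at R l) (+-suc k m) ≼-refl)
        (trans (cong (height ∘ at R) (+-suc k m)) (height-tail (suc k)))

-- Components and up-closures in the connectoid.

module Ends (em : ∀ {ℓ} → ExcludedMiddle ℓ) {a} {S : Set a} (𝒞 : Connectoid S)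
            (T : RootedTree S) (weakNormal : IsWeakNormalTree 𝒞 T)
            (spanning : RootedTree.IsSpanning T) where
  open Connectoid 𝒞
  open RootedTree T using (Ray; _≈ᴿ_)
  open Rays em T spanning
  open IsWeakNormalTree weakNormal

  -- Members of 𝓕 are given by lists so that the component of x in P,
  -- Linked P x, is again a predicate at level a.
  Linked : Pred S a → S → S → Set a
  Linked P x y = ∃[ xs ] (_∈ₗ xs) ∈ 𝓕 × (_∈ₗ xs) ⊆ P × x ∈ₗ xs × y ∈ₗ xs

  connected⇒linked : ∀ {C P x y} → Connected C → C ⊆ P → x ∈ C → y ∈ C → Linked P x y
  connected⇒linked conn C⊆P x∈ y∈ =
    let F , F∈ , F⊆C , x∈F , y∈F = conn x∈ y∈
        xs , F⊆xs , xs⊆F         = finite F∈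
    in xs , 𝓕-resp (F⊆xs , xs⊆F) F∈ , C⊆P ∘ F⊆C ∘ xs⊆F , F⊆xs x∈F , F⊆xs y∈F

  linked⇒connected : ∀ {C} → (∀ {x y} → x ∈ C → y ∈ C → Linked C x y) → Connected C
  linked⇒connected linked x∈ y∈ = let xs , rest = linked x∈ y∈ in (_∈ₗ xs) , rest

  linked-sym : ∀ {P x y} → Linked P x y → Linked P y x
  linked-sym (xs , xs∈ , xs⊆P , x∈ , y∈) = xs , xs∈ , xs⊆P , y∈ , x∈

  linked-trans : ∀ {P x y z} → Linked P x y → Linked P y z → Linked P x z
  linked-trans {P} (xs , xs∈ , xs⊆P , x∈ , y∈) (ys , ys∈ , ys⊆P , y∈′ , z∈) =
    xs ++ ys
    , 𝓕-resp (∪⊆++ , ∈-++⁻ xs) (∪-∈ xs∈ ys∈ (_ , y∈ , y∈′))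
    , (λ w∈ → case ∈-++⁻ xs w∈ of λ where
        (inj₁ w∈) → xs⊆P w∈
        (inj₂ w∈) → ys⊆P w∈)
    , ∈-++⁺ˡ x∈ , ∈-++⁺ʳ xs z∈
    where
    ∪⊆++ : ((_∈ₗ xs) ∪ (_∈ₗ ys)) ⊆ (_∈ₗ (xs ++ ys))
    ∪⊆++ (inj₁ w∈) = ∈-++⁺ˡ w∈
    ∪⊆++ (inj₂ w∈) = ∈-++⁺ʳ xs w∈

  ｛｝-connected : ∀ x → Connected ｛ x ｝
  ｛｝-connected x refl refl = ｛ x ｝ , ｛｝-∈ x , id , refl , refl

  linked-refl : ∀ {P x} → x ∈ P → Linked P x x
  linked-refl {x = x} x∈ = connected⇒linked (｛｝-connected x) (λ { refl → x∈ }) refl refl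

  linked-isComponent : ∀ {P x} → x ∈ P → Linked P x ∈ 𝓚 P
  linked-isComponent {P} {x} x∈ = record
    { subset    = λ (xs , _ , xs⊆P , _ , y∈) → xs⊆P y∈
    ; connected = linked⇒connected λ y~ z~ → linked-trans (linked-sym (centre y~)) (centre z~)
    ; maximal   = λ conn C⊆P K⊆C y∈ → connected⇒linked conn C⊆P (K⊆C (linked-refl x∈)) y∈
    }
    where
    -- A list linking `x` to `y` links `x` to each of its members, so it lies inside the class of
    -- `x`.
    centre : ∀ {y} → Linked P x y → Linked (Linked P x) x y
    centre (xs , xs∈ , xs⊆P , x∈xs , y∈) =
      xs , xs∈ , (λ z∈ → xs , xs∈ , xs⊆P , x∈xs , z∈) , x∈xs , y∈

  Up : S → Pred S a
  Up t = t ≼_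

  -- If `x` is not below some `y` in `C`, then either `y` is strictly below `x`, or weak normality
  -- gives a common lower bound in `C`, strictly below `x`. The height drops, so this descent ends.
  minimum : ∀ {C x} → Connected C → x ∈ C → ∃[ w ] w ∈ C × C ⊆ Up w
  minimum {C} conn x∈ = go _ ≤-refl x∈
    where
    go : ∀ {x} b → height x ≤ b → x ∈ C → ∃[ w ] w ∈ C × C ⊆ Up w
    lower : ∀ {x w} b → height x ≤ b → w ∈ C → w ≼ x → w ≢ x → ∃[ w ] w ∈ C × C ⊆ Up w
    go {x} b ≤b x∈ with em {P = ∃[ y ] y ∈ C × ¬ (x ≼ y)}
    ... | no none = x , x∈ , λ {y} y∈ → case em {P = x ≼ y} of λ where
      (yes x≼y) → x≼y
      (no  x⋠y) → ⊥-elim (none (y , y∈ , x⋠y))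
    ... | yes (y , y∈ , x⋠y) with em {P = y ≼ x}
    ...   | yes y≼x = lower b ≤b y∈ y≼x λ { refl → x⋠y ≼-refl }
    ...   | no  y⋠x with incomparable conn (x∈ , spanning x) (y∈ , spanning y)
                           (x⋠y ∘ ≤ᵀ⇒≼) (y⋠x ∘ ≤ᵀ⇒≼)
    ...     | w , w∈ , w≤x , w≤y = lower b ≤b w∈ (≤ᵀ⇒≼ w≤x) λ { refl → x⋠y (≤ᵀ⇒≼ w≤y) }
    lower b ≤b w∈ w≼x w≢x with ≼⇒≡⊎< w≼x
    ... | inj₁ w≡x = ⊥-elim (w≢x w≡x)
    lower zero    ≤b w∈ w≼x w≢x | inj₂ w<x = case ≤-trans w<x ≤b of λ ()
    lower (suc b) ≤b w∈ w≼x w≢x | inj₂ w<x = go b (s≤s⁻¹ (≤-trans w<x ≤b)) w∈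

  -- The minimum of `C` and `t` both lie below `y`, hence are comparable; as `C` avoids `Below t`,
  -- the minimum is above `t`.
  connected-⊆-Up : ∀ {C t y} → Connected C → C ⊆ ∁ (Below t) → y ∈ C → t ≼ y → C ⊆ Up t
  connected-⊆-Up {t = t} conn avoids y∈ t≼y x∈ with minimum conn y∈
  ... | w , w∈ , C⊆ with ≼-below-total (C⊆ y∈) t≼y
  ...   | inj₂ t≼w = ≼-trans t≼w (C⊆ x∈)
  ...   | inj₁ w≼t with em {P = w ≡ t}
  ...     | yes refl = C⊆ x∈
  ...     | no  w≢t  = ⊥-elim (avoids w∈ (w≼t , w≢t))

  -- The connected set given by weak normality contains `t` and misses `Down° t`, so it cannot leave
  -- `Up t`.
  Up-linked : ∀ {t x} → t ≼ x → Linked (Up t) t x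
  Up-linked {t} {x} t≼x with comparable (spanning t) (spanning x) (≼⇒≤ᵀ t≼x)
  ... | C , conn , t∈ , x∈ , C⊥ = connected⇒linked conn
    (connected-⊆-Up conn (λ y∈ (y≼t , y≢t) → C⊥ (y∈ , ≼⇒≤ᵀ y≼t , y≢t ∘ sym)) t∈ ≼-refl) t∈ x∈

  Up-connected : ∀ t → Connected (Up t)
  Up-connected t = linked⇒connected λ t≼x t≼y →
    linked-trans (linked-sym (Up-linked t≼x)) (Up-linked t≼y)

  -- Tails of a necklace and its branch.

  module _ (N : Necklace) where
    open IsNecklace (proj₂ N)

    -- Easier to handle than `IsTail`: almost all of `N` lies in `P` iff some `Tail m` does, by
    -- `⊆ᶠ⇒tail-⊆` and `tail-⊆⇒⊆ᶠ`.
    Tail : ℕ → Pred S a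
    Tail m x = ∃[ n ] m ≤ n × x ∈ H n

    tail-⊆ : ∀ {m n} → m ≤ n → Tail n ⊆ Tail m
    tail-⊆ m≤n (k , n≤k , x∈) = k , ≤-trans m≤n n≤k , x∈

    tail-⊆-N : ∀ {m} → Tail m ⊆ proj₁ N
    tail-⊆-N (n , _ , x∈) = proj₂ N≐⋃H (n , x∈)

    tail-point : ∀ m → ∃[ x ] x ∈ Tail m
    tail-point m with Equivalence.from (H-meet m m) (subst (_≤ 1) (sym (∣n-n∣≡0 m)) z≤n)
    ... | x , x∈ , _ = x , m , ≤-refl , x∈

    tails-meet : ∀ {ℓ ℓ′} {P : Pred S ℓ} {Q : Pred S ℓ′} m n → Tail m ⊆ P → Tail n ⊆ Q → P ≬ Q
    tails-meet m n m⊆P n⊆Q with tail-point (m ⊔ n)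
    ... | x , x∈ = x , m⊆P (tail-⊆ (m≤m⊔n m n) x∈) , n⊆Q (tail-⊆ (m≤n⊔m m n) x∈)

    tail-connected : ∀ m → Connected (Tail m)
    tail-connected m = linked⇒connected linked
      where
      ∣n-1+n∣≤1 : ∀ n → ∣ n - suc n ∣ ≤ 1
      ∣n-1+n∣≤1 zero    = ≤-refl
      ∣n-1+n∣≤1 (suc n) = ∣n-1+n∣≤1 n

      linked-up : ∀ {i x y} d → m ≤ i → x ∈ H i → y ∈ H (d + i) → Linked (Tail m) x y
      linked-up {i} zero m≤i x∈ y∈ =
        connected⇒linked (H-connected i) (λ z∈ → i , m≤i , z∈) x∈ y∈
      linked-up {i} (suc d) m≤i x∈ y∈
        with Equivalence.from (H-meet (d + i) (suc d + i)) (∣n-1+n∣≤1 (d + i))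
      ... | z , z∈ , z∈′ = linked-trans (linked-up d m≤i x∈ z∈)
        (connected⇒linked (H-connected (suc d + i)) (λ w∈ → _ , m≤n⇒m≤o+n (suc d) m≤i , w∈) z∈′ y∈)

      linked : ∀ {x y} → x ∈ Tail m → y ∈ Tail m → Linked (Tail m) x y
      linked {x} {y} (i , m≤i , x∈) (j , m≤j , y∈) with ≤-total i j
      ... | inj₁ i≤j = linked-up (j ∸ i) m≤i x∈ (subst (λ k → y ∈ H k) (sym (m∸n+n≡m i≤j)) y∈)
      ... | inj₂ j≤i = linked-sym
        (linked-up (i ∸ j) m≤j y∈ (subst (λ k → x ∈ H k) (sym (m∸n+n≡m j≤i)) x∈))

    -- A point of `H i` lies in no `H n` with `n` at least `i + 2`.
    tail-avoids : ∀ xs → ∃[ m ] Tail m ⊆ ∁ (_∈ₗ xs)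
    tail-avoids xs with eventually-avoids em {Q = H} (λ {_} {i} x∈ → 2 + i , λ {n} i+2≤n x∈′ →
      <-irrefl refl (begin-strict
        n             ≤⟨ m≤n+∣n-m∣ n i ⟩
        i + ∣ i - n ∣ ≤⟨ +-monoʳ-≤ i (Equivalence.to (H-meet i n) (_ , x∈ , x∈′)) ⟩
        i + 1         ≡⟨ +-comm i 1 ⟩
        1 + i         <⟨ i+2≤n ⟩
        n             ∎)) xs
      where open ≤-Reasoning
    ... | m , avoids = m , λ (n , m≤n , x∈) x∈xs → avoids m≤n x∈xs x∈

    ⊆ᶠ⇒tail-⊆ : ∀ {ℓ} {P : Pred S ℓ} → proj₁ N ⊆ᶠ P → ∃[ m ] Tail m ⊆ P
    ⊆ᶠ⇒tail-⊆ {P = P} (xs , rest⊆xs , _) with tail-avoids xs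
    ... | m , avoids = m , λ {x} x∈ → case em {P = x ∈ P} of λ where
      (yes x∈P) → x∈P
      (no  x∉P) → ⊥-elim (avoids x∈ (rest⊆xs (tail-⊆-N x∈ , x∉P)))

    initial-finite : ∀ m → ∃[ xs ] ∀ {i} → i < m → H i ⊆ (_∈ₗ xs)
    initial-finite zero = [] , λ ()
    initial-finite (suc m) with initial-finite m | H-finite m
    ... | xs , ⊆xs | ys , ⊆ys , _ = xs ++ ys , λ i<1+m x∈ → case m<1+n⇒m<n∨m≡n i<1+m of λ where
      (inj₁ i<m)  → ∈-++⁺ˡ (⊆xs i<m x∈)
      (inj₂ refl) → ∈-++⁺ʳ xs (⊆ys x∈)

    -- The exceptions lie in the first `m` sets `H i`, each finite.
    tail-⊆⇒⊆ᶠ : ∀ {ℓ} {P : Pred S ℓ} m → Tail m ⊆ P → proj₁ N ⊆ᶠ P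
    tail-⊆⇒⊆ᶠ m m⊆P with initial-finite m
    ... | xs , ⊆xs = finite-⊆ em xs λ (x∈N , x∉P) → let i , x∈ = proj₁ N≐⋃H x∈N in
      ⊆xs (≰⇒> λ m≤i → x∉P (m⊆P (i , m≤i , x∈))) x∈

    Dominated : Pred S a
    Dominated t = ∃[ m ] Tail m ⊆ Up t

    dominated-isBranch : IsBranch Dominated
    dominated-isBranch = record
      -- Two tails share a point, which lies above both `s` and `t`.
      { chain  = λ (m , m⊆) (n , n⊆) → let _ , s≼ , t≼ = tails-meet m n m⊆ n⊆ in
          ≼-below-total s≼ t≼
      ; closed = λ s≼t (m , m⊆) → m , ≼-trans s≼t ∘ m⊆
      ; tall   = tall
      }
      where
      -- Take the minimum of a tail of N inside Up t that avoids everything below t.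
      higher : ∀ {t} → t ∈ Dominated → ∃[ s ] s ∈ Dominated × height t < height s
      higher {t} (m , m⊆)
        with k , avoids ← tail-avoids (down t)
        with s , s∈ , ⊆Up ← minimum (tail-connected (m ⊔ k)) (proj₂ (tail-point (m ⊔ k)))
        with ≼⇒≡⊎< (m⊆ (tail-⊆ (m≤m⊔n m k) s∈))
      ... | inj₁ refl = ⊥-elim (avoids (tail-⊆ (m≤n⊔m m k) s∈) ≼-refl)
      ... | inj₂ t<s  = s , (m ⊔ k , ⊆Up) , t<s

      tall : ∀ n → ∃[ t ] t ∈ Dominated × n < height t
      tall zero = _ , (0 , λ _ → root-≼ _) , subst (0 <_) (sym height-root) (s≤s z≤n)
      tall (suc n) =
        let t , t∈ , n<t = tall n
            s , s∈ , t<s = higher t∈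
        in s , s∈ , ≤-<-trans n<t t<s

    -- A `Tail m` missing `X` is connected, so the component of any of its points contains all of
    -- it.
    tail-exists : ∀ {X} → Finite X → ∃[ K ] IsTail X (proj₁ N) K
    tail-exists {X} (xs , X⊆xs , _)
      with m , avoids ← tail-avoids xs
      with x , x∈ ← tail-point m = Linked (proj₁ N ∖ X) x ,
        linked-isComponent (tail⊆ x∈) ,
        tail-⊆⇒⊆ᶠ m (λ y∈ → connected⇒linked (tail-connected m) tail⊆ x∈ y∈)
      where
      tail⊆ : Tail m ⊆ (proj₁ N ∖ X)
      tail⊆ y∈ = tail-⊆-N y∈ , avoids y∈ ∘ X⊆xs

    -- The `X`-tail meets `Up t`, which is connected and misses `X`; so all of the tail is linked to
    -- `t` outside `X`.
    tail-in-component : ∀ {X t} → Finite X → t ∈ Dominated → Up t ⊆ ∁ X →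
      ∃[ K ] IsTail X (proj₁ N) K × K ⊆ Linked (∁ X) t
    tail-in-component {t = t} fin (m , m⊆) Up⊆
      with K , isComp , N⊆ᶠK ← tail-exists fin
      with n , n⊆ ← ⊆ᶠ⇒tail-⊆ N⊆ᶠK
      with x , t≼x , x∈ ← tails-meet m n m⊆ n⊆ = K , (isComp , N⊆ᶠK) , λ y∈ → linked-trans
        (connected⇒linked (Up-connected t) Up⊆ ≼-refl t≼x)
        (connected⇒linked (IsComponent.connected isComp)
          (λ z∈ → proj₂ (IsComponent.subset isComp z∈)) x∈ y∈)

  -- A dominated `t` higher than all of `X` has `Up t` disjoint from `X`, and the component of `t`
  -- then receives both tails. A single such `t` is enough, hence only one inclusion.
  Dominated-⊆⇒≈ᴺ : ∀ N₁ N₂ → Dominated N₁ ⊆ Dominated N₂ → N₁ ≈ᴺ N₂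
  Dominated-⊆⇒≈ᴺ N₁ N₂ ⊆₂ X fin@(xs , X⊆xs , _)
    with t , t∈ , high ← IsBranch.tall (dominated-isBranch N₁) (max 0 (map height xs)) =
    Linked (∁ X) t , linked-isComponent (Up⊆ ≼-refl) ,
    tail-in-component N₁ fin t∈ Up⊆ , tail-in-component N₂ fin (⊆₂ t∈) Up⊆
    where
    Up⊆ : Up t ⊆ ∁ X
    Up⊆ t≼x x∈ = <⇒≱ high (≤-trans (≼⇒height≤ t≼x)
      (All.lookup (xs≤max 0 (map height xs)) (∈-map⁺ height (X⊆xs x∈))))

  Below-finite : ∀ t → Finite (Below t)
  Below-finite t = finite-⊆ em (down t) proj₁

  -- After deleting `Below t`, the common component `D` meets `Up t` in a point of `N₁`, so it lies
  -- in `Up t` and brings a tail of `N₂` along.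
  ≈ᴺ⇒Dominated-⊆ : ∀ N₁ N₂ → N₁ ≈ᴺ N₂ → Dominated N₁ ⊆ Dominated N₂
  ≈ᴺ⇒Dominated-⊆ N₁ N₂ N₁≈N₂ {t} (m , m⊆)
    with D , isComp , (K₁ , (_ , N₁⊆) , K₁⊆D) , (K₂ , (_ , N₂⊆) , K₂⊆D) ←
           N₁≈N₂ (Below t) (Below-finite t)
    with n₁ , n₁⊆ ← ⊆ᶠ⇒tail-⊆ N₁ N₁⊆
    with n₂ , n₂⊆ ← ⊆ᶠ⇒tail-⊆ N₂ N₂⊆
    with x , t≼x , x∈ ← tails-meet N₁ m n₁ m⊆ n₁⊆ = n₂ , λ y∈ →
      connected-⊆-Up (IsComponent.connected isComp) (IsComponent.subset isComp) (K₁⊆D x∈) t≼x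
        (K₂⊆D (n₂⊆ y∈))

  ≈ᴺ-isEquivalence : IsEquivalence _≈ᴺ_
  ≈ᴺ-isEquivalence = record
    { refl  = λ {N} → Dominated-⊆⇒≈ᴺ N N id
    ; sym   = λ N₁≈N₂ X fin → let D , isComp , K₁ , K₂ = N₁≈N₂ X fin in D , isComp , K₂ , K₁
    -- Passing through `Dominated` avoids having to identify two components of `∁ X`.
    ; trans = λ {N₁} {N₂} {N₃} N₁≈N₂ N₂≈N₃ → Dominated-⊆⇒≈ᴺ N₁ N₃
        (≈ᴺ⇒Dominated-⊆ N₂ N₃ N₂≈N₃ ∘ ≈ᴺ⇒Dominated-⊆ N₁ N₂ N₁≈N₂)
    }

  -- The map from necklaces to rays.

  necklaceRay : Necklace → Ray
  necklaceRay N = IsBranch.ray (dominated-isBranch N)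

  Dominated-⊆⇒≈ᴿ : ∀ {ℓ} {P : Pred S ℓ} N (p : IsBranch P) → Dominated N ⊆ P →
    necklaceRay N ≈ᴿ IsBranch.ray p
  Dominated-⊆⇒≈ᴿ N p ⊆P = common-tail⇒≈ᴿ (necklaceRay N) (IsBranch.ray p) 0 0 λ k →
    branch-⊆⇒≡ (dominated-isBranch N) p ⊆P (k + 0)

  -- For `t` dominated by `N₁`, delete `Below t`. The first ray's remaining vertex is comparable to
  -- `t`, hence above it; the walk cannot leave the up-closure of `t`, so `t` is below a vertex of
  -- the second ray.
  necklaceRay-injective : ∀ N₁ N₂ → necklaceRay N₁ ≈ᴿ necklaceRay N₂ → N₁ ≈ᴺ N₂
  necklaceRay-injective N₁ N₂ R₁≈R₂ = Dominated-⊆⇒≈ᴺ N₁ N₂ ⊆₂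
    where
    open IsBranch
    b₁ = dominated-isBranch N₁
    b₂ = dominated-isBranch N₂

    ⊆₂ : Dominated N₁ ⊆ Dominated N₂
    ⊆₂ {t} t∈ with R₁≈R₂ (Below t) (Below-finite t) (λ _ → spanning _)
    ... | m , n , m-out , _ , walk = closed b₂ (≼-walk t≼ walk) (vertex∈ b₂ n)
      where
      t≼ : t ≼ vertex b₁ m
      t≼ with chain b₁ t∈ (vertex∈ b₁ m) | em {P = vertex b₁ m ≡ t}
      ... | inj₁ t≼ | _       = t≼
      ... | inj₂ _  | yes eq  = subst (t ≼_) (sym eq) ≼-refl
      ... | inj₂ ≼t | no  neq = ⊥-elim (m-out m ≤-refl (≼t , neq))

  necklaceRay-through : ∀ {ℓ} {P : Pred S ℓ} N (p : IsBranch P) →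
    Ray.vertexSet (IsBranch.ray p) ⊆ᶠ proj₁ N → necklaceRay N ≈ᴿ IsBranch.ray p
  necklaceRay-through {P = P} N p (xs , R∖N⊆xs , _) = Dominated-⊆⇒≈ᴿ N p ⊆P
    where
    open IsBranch p
    ⊆P : Dominated N ⊆ P
    ⊆P {t} (m , m⊆)
      with ys , N∖Up⊆ys , _ ← tail-⊆⇒⊆ᶠ N m m⊆
      -- `xs` covers the ray vertices outside `N`, `ys` the points of `N` not above `t`; a ray
      -- vertex outside both lies above `t`, which puts `t` in `P`.
      with k , avoids ← ray-avoids ray (xs ++ ys)
      with em {P = vertex k ∈ proj₁ N}
    ... | no  ∉N = ⊥-elim (avoids ≤-refl (∈-++⁺ˡ (R∖N⊆xs ((k , refl) , ∉N))))
    ... | yes ∈N with em {P = t ≼ vertex k}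
    ...   | yes t≼ = closed t≼ (vertex∈ k)
    ...   | no  t⋠ = ⊥-elim (avoids ≤-refl (∈-++⁺ʳ xs (N∖Up⊆ys (∈N , t⋠))))

theorem1p2 : (∀ {ℓ} → ExcludedMiddle ℓ) →
    ∀ {a} {S : Set a} (𝒞 : Connectoid S) (T : RootedTree S) →
    IsNormalTree 𝒞 T → RootedTree.IsSpanning T →
    ∃ λ (f : Connectoid.Necklace 𝒞 → RootedTree.Ray T) →
      IsBijection (Connectoid._≈ᴺ_ 𝒞) (RootedTree._≈ᴿ_ T) f
theorem1p2 em 𝒞 T normal spanning = necklaceRay , record
  { isInjection = record
    { isCongruent = record
      { cong           = λ {N₁} {N₂} → necklaceRay-cong N₁ N₂
      ; isEquivalence₁ = ≈ᴺ-isEquivalence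
      ; isEquivalence₂ = ≈ᴿ-isEquivalence
      }
    ; injective = λ {N₁} {N₂} → necklaceRay-injective N₁ N₂
    }
  ; surjective = λ R →
      -- Normality provides necklaces for rooted rays only, so `R` is first replaced by an
      -- equivalent rooted ray.
      let b       = belowTail-isBranch R
          N , R⊆N = rays (IsBranch.ray b) (IsBranch.ray-rooted b)
      in N , λ {N′} N′≈N → ≈ᴿ-trans {necklaceRay N′} {necklaceRay N} {R}
           (necklaceRay-cong N′ N N′≈N)
           (≈ᴿ-trans {necklaceRay N} {IsBranch.ray b} {R}
             (necklaceRay-through N b R⊆N) (rooted-≈ᴿ R))
  }
  where
  open IsNormalTree normal
  open Rays em T spanning
  open Ends em 𝒞 T isWeakNormalTree spanning
  open IsEquivalence ≈ᴿ-isEquivalence using () renaming (trans to ≈ᴿ-trans)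

  necklaceRay-cong : ∀ N₁ N₂ → Connectoid._≈ᴺ_ 𝒞 N₁ N₂ →
    RootedTree._≈ᴿ_ T (necklaceRay N₁) (necklaceRay N₂)
  necklaceRay-cong N₁ N₂ N₁≈N₂ =
    Dominated-⊆⇒≈ᴿ N₁ (dominated-isBranch N₂) (≈ᴺ⇒Dominated-⊆ N₁ N₂ N₁≈N₂)
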